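{- Let $P\subset\mathbb R^d$ be a $d$-polytope with $d\geq 3$, let $S$ be a simplex facet of $P$ in bounded position, and let $\mathcal F,\mathcal N\subseteq\operatorname{adj}(S)$ be disjoint with $\mathcal F$ nonsimple. Let $v\in V_S(\mathcal F,\mathcal N;P)$ and $Q=\operatorname{conv}(P\cup\{v\})$. Then for $0\leq k\leq d-2$, a $k$-face $G$ of $P$ is a $k$-face of $Q$ if and only if there is a facet $F$ of $P$ with $F\notin\mathcal F\cup\mathcal N\cup\{S\}$ and $G\subseteq F$.
   Context: For a facet $F$ of a $d$-polytope $P\subset\mathbb R^d$ let $H_F=\{x:\langle x,a_F\rangle=\ell_F\}$ be its affine hull, oriented so that $P\subseteq\{x:\langle x,a_F\rangle\geq \ell_F\}$; put $H_F^+=\{x:\langle x,a_F\rangle>\ell_F\}$, $H_F^-=\{x:\langle x,a_F\rangle<\ell_F\}$. Two facets are adjacent if they share a ridge ($(d-2)$-face); $\operatorname{adj}(S)$ is the set of facets adjacent to the facet $S$. A simplex facet is a facet combinatorially equivalent to a $(d-1)$-simplex. A facet $S$ is in bounded position if for every set of $d$ facets in $\operatorname{adj}(S)$ the hyperplanes $H_F$ of these facets intersect in a point of $H_S^-$. A subset $\mathcal F\subseteq\operatorname{adj}(S)$ is nonsimple if there is no pair of adjacent facets $G,G'\in\mathcal F$ having a common $(d-3)$-face with $S$. For disjoint $\mathcal F,\mathcal N\subseteq\operatorname{adj}(S)$, $V_S(\mathcal F,\mathcal N;P)$ is the set of points lying in $H_F^-$ for all $F\in\mathcal N\cup\{S\}$,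 in $H_F$ for all $F\in\mathcal F$, and in $H_F^+$ for all other facets $F$ of $P$. (The polytope $Q$ is called the pseudo-stacking of $P$ above $S$ with respect to $\mathcal F,\mathcal N$.) -}

module Defs where

open import Algebra.Bundles using (CommutativeRing)
open import Data.Fin.Base using (Fin)
open import Data.Nat.Base as ℕ using (ℕ; suc; _∸_)
open import Data.Product.Base using (Σ; ∃; ∃-syntax; _×_; proj₁)
open import Data.Vec.Functional using (Vector)
open import Function.Bundles using (_⇔_)
open import Function.Definitions using (Injective)
open import Level using (0ℓ) renaming (suc to lsuc)
open import Relation.Binary.Core using (Rel)
open import Relation.Binary.Morphism.Structures using (IsOrderIsomorphism)
open import Relation.Binary.PropositionalEquality.Core using (_≡_)
open import Relation.Binary.Structures using (IsTotalOrder)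
open import Relation.Nullary.Negation.Core using (¬_)
open import Relation.Unary using (Pred; _∈_; _∉_; _⊆_; _≐_; _∪_; _∩_)

-- The field of real numbers, characterised (classically, up to isomorphism)
-- as the Dedekind-complete ordered field.
record CompleteOrderedField : Set₁ where
  infix 4 _≤_
  field
    commutativeRing : CommutativeRing 0ℓ 0ℓ

  open CommutativeRing commutativeRing public

  field
    _≤_          : Rel Carrier 0ℓ
    isTotalOrder : IsTotalOrder _≈_ _≤_
    0≉1          : ¬ (0# ≈ 1#)
    inverse      : ∀ x → ¬ (x ≈ 0#) → ∃[ y ] x * y ≈ 1#
    +-mono-≤     : ∀ {x y} z → x ≤ y → x + z ≤ y + z
    *-nonneg     : ∀ {x y} → 0# ≤ x → 0# ≤ y → 0# ≤ x * y

  UpperBound : Pred Carrier 0ℓ → Pred Carrier 0ℓ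
  UpperBound A b = ∀ x → x ∈ A → x ≤ b

  field
    supremum : (A : Pred Carrier 0ℓ) → ∃ A → ∃ (UpperBound A) →
               ∃[ s ] (s ∈ UpperBound A × (∀ b → b ∈ UpperBound A → s ≤ b))

  open import Relation.Binary.Construct.NonStrictToStrict _≈_ _≤_ public
    using (_<_)
  open import Algebra.Definitions.RawMonoid +-rawMonoid public
    using (sum)

module Polytopes (ℝ : CompleteOrderedField) (d : ℕ) where

  open CompleteOrderedField ℝ

  Point : Set
  Point = Vector Carrier d

  infix 4 _≋_
  _≋_ : Rel Point 0ℓ
  x ≋ y = ∀ i → x i ≈ y i

  ⟨_,_⟩ : Point → Point → Carrier
  ⟨ x , y ⟩ = sum (λ i → x i * y i)

  -- Σⱼ wⱼ pⱼ
  comb : ∀ {n} → Vector Carrier n → Vector Point n → Point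
  comb w p i = sum (λ j → w j * p j i)

  Region : Set₁
  Region = Pred Point 0ℓ

  range : ∀ {n} → Vector Point n → Region
  range p x = ∃[ i ] x ≋ p i

  aff : Region → Region
  aff X x = ∃[ n ] Σ (Vector Point n) λ p → Σ (Vector Carrier n) λ w →
    (∀ i → p i ∈ X) × sum w ≈ 1# × x ≋ comb w p

  conv : Region → Region
  conv X x = ∃[ n ] Σ (Vector Point n) λ p → Σ (Vector Carrier n) λ w →
    (∀ i → p i ∈ X) × (∀ i → 0# ≤ w i) × sum w ≈ 1# × x ≋ comb w p

  AffinelyIndependent : ∀ {n} → Vector Point n → Set
  AffinelyIndependent p =
    ∀ w → sum w ≈ 0# → comb w p ≋ (λ _ → 0#) → ∀ i → w i ≈ 0#

  -- dim X = dim (aff X) = k: X contains an affine basis, of k + 1 points,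
  -- of its affine hull.
  HasDim : Region → ℕ → Set
  HasDim X k = Σ (Vector Point (suc k)) λ p →
    (∀ i → p i ∈ X) × AffinelyIndependent p × X ⊆ aff (range p)

  IsPolytope : Region → Set
  IsPolytope P = ∃[ n ] Σ (Vector Point n) λ p → P ≐ conv (range p)

  IsFullPolytope : Region → Set
  IsFullPolytope P = IsPolytope P × HasDim P d

  Hyp Hyp≥ Hyp> Hyp< : Point → Carrier → Region
  Hyp  a ℓ x = ⟨ x , a ⟩ ≈ ℓ
  Hyp≥ a ℓ x = ℓ ≤ ⟨ x , a ⟩
  Hyp> a ℓ x = ℓ < ⟨ x , a ⟩
  Hyp< a ℓ x = ⟨ x , a ⟩ < ℓ

  -- The vector a may be zero, so ∅ and P itself count as (improper) faces.
  IsFace : Region → Region → Set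
  IsFace P G = ∃[ a ] ∃[ ℓ ] (P ⊆ Hyp≥ a ℓ) × (G ≐ (P ∩ Hyp a ℓ))

  IsKFace : Region → ℕ → Region → Set
  IsKFace P k G = IsFace P G × HasDim G k

  IsFacet : Region → Region → Set
  IsFacet P F = IsKFace P (d ∸ 1) F

  Face : Region → Set₁
  Face P = Σ Region (IsFace P)

  -- Isomorphism of face lattices (faces ordered by inclusion).
  CombinatoriallyEquivalent : Region → Region → Set₁
  CombinatoriallyEquivalent P Q = Σ (Face P → Face Q) λ f →
    IsOrderIsomorphism
      (λ G G′ → proj₁ G ≐ proj₁ G′) (λ G G′ → proj₁ G ≐ proj₁ G′)
      (λ G G′ → proj₁ G ⊆ proj₁ G′) (λ G G′ → proj₁ G ⊆ proj₁ G′)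
      f

  IsSimplex : ℕ → Region → Set
  IsSimplex k T = Σ (Vector Point (suc k)) λ p →
    AffinelyIndependent p × T ≐ conv (range p)

  IsSimplexFacet : Region → Region → Set₁
  IsSimplexFacet P S = IsFacet P S ×
    ∃[ T ] IsSimplex (d ∸ 1) T × CombinatoriallyEquivalent S T

  H : Region → Region
  H F = aff F

  -- (a , ℓ) plays the role of (a_F , ℓ_F); for a facet F of a full-dimensional
  -- P such a pair exists and is unique up to a positive factor.
  Orients : Region → Region → Point → Carrier → Set
  Orients P F a ℓ = (H F ≐ Hyp a ℓ) × (P ⊆ Hyp≥ a ℓ)

  H⁺ H⁻ : Region → Region → Region
  H⁺ P F x = ∃[ a ] ∃[ ℓ ] Orients P F a ℓ × x ∈ Hyp> a ℓ
  H⁻ P F x = ∃[ a ] ∃[ ℓ ] Orients P F a ℓ × x ∈ Hyp< a ℓ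

  Adjacent : Region → Region → Region → Set₁
  Adjacent P F G = IsFacet P F × IsFacet P G × ¬ (F ≐ G) ×
    ∃[ R ] IsKFace P (d ∸ 2) R × R ⊆ F × R ⊆ G

  Family : Set₂
  Family = Pred Region (lsuc 0ℓ)

  adj : Region → Region → Family
  adj P S F = Adjacent P S F

  BoundedPosition : Region → Region → Set₁
  BoundedPosition P S =
    (F : Fin d → Region) → Injective _≡_ _≐_ F → (∀ i → F i ∈ adj P S) →
    ∃[ x ] x ∈ H⁻ P S × (∀ y → (∀ i → y ∈ H (F i)) ⇔ y ≋ x)

  Nonsimple : Region → Region → Family → Set₁
  Nonsimple P S 𝓕 = ¬ (∃[ G ] ∃[ G′ ] G ∈ 𝓕 × G′ ∈ 𝓕 × Adjacent P G G′ ×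
    ∃[ K ] IsKFace P (d ∸ 3) K × K ⊆ G × K ⊆ G′ × K ⊆ S)

  V : Region → Region → Family → Family → Pred Point (lsuc 0ℓ)
  V P S 𝓕 𝓝 x =
    (∀ F → F ∈ 𝓝 ∪ (_≐ S) → x ∈ H⁻ P F) ×
    (∀ F → F ∈ 𝓕 → x ∈ H F) ×
    (∀ F → IsFacet P F → F ∉ 𝓕 ∪ 𝓝 ∪ (_≐ S) → x ∈ H⁺ P F)

{-# OPTIONS --safe #-}

-- This is the face criterion for adding one point v to a polytope P (Grünbaum, Convex
-- Polytopes, 5.2.1).  Write Q = conv (P ∪ {v}).
-- If G lies in a facet F with v strictly beneath F, then adding a large multiple of the
-- inequality of F to one that defines G in P gives an inequality that defines G in Q.
-- Conversely, an inequality defining G in Q is valid on P, tight on G and strict at v.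
-- As long as its tight points span less than a hyperplane, rotate it about an axis through
-- them and v until a further generator of P becomes tight; the value at v does not change.
-- The end result is a facet of P that contains G and has v strictly beneath it, hence a
-- facet outside 𝓕 ∪ 𝓝 ∪ {S}.
module Submission where

open import Defs
open import Axiom.ExcludedMiddle using (ExcludedMiddle)
open import Data.Empty using (⊥-elim) renaming (⊥ to Empty)
open import Data.Fin.Base using (Fin; zero; suc; punchIn; punchOut)
open import Data.Fin.Properties using (punchIn-punchOut) renaming (_≟_ to _≟ᶠ_)
open import Data.Nat.Base using (ℕ; zero; suc; _≤_; _∸_; _≤′_; ≤′-refl; ≤′-step; s≤s)
import Data.Nat.Base as ℕ
import Data.Nat.Properties as ℕ
open import Data.Product.Base using (Σ; ∃-syntax; _×_; _,_; proj₁; proj₂)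
open import Data.Sum.Base using (_⊎_; inj₁; inj₂)
open import Data.Vec.Functional using (Vector; _∷_; []; insertAt)
open import Data.Vec.Functional.Properties using (insertAt-lookup; insertAt-punchIn)
open import Function.Base using (_∘_)
open import Function.Bundles using (_⇔_; mk⇔)
open import Relation.Binary.Definitions using (_Respects_)
open import Relation.Binary.PropositionalEquality.Core as ≡ using ()
open import Relation.Binary.Structures using (IsTotalOrder)
open import Relation.Nullary using (¬_; yes; no)
open import Relation.Unary using (_∈_; _∉_; _⊆_; _≐_; _∪_; _∩_; _⊥_)

module _ (em : ∀ {ℓ} → ExcludedMiddle ℓ) (ℝ : CompleteOrderedField) where

  open CompleteOrderedField ℝ hiding (zero) renaming (_≤_ to infix 4 _≤ᵣ_)
  module ≤ = IsTotalOrder isTotalOrder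
  open import Algebra.Properties.Ring ring
  open import Algebra.Properties.Semiring.Sum semiring
    using (sum-cong-≋; sum-remove; ∑-distrib-+; ∑-comm; *-distribˡ-sum; *-distribʳ-sum; sum-replicate-zero)
  open import Algebra.Solver.Ring.NaturalCoefficients.Default commutativeSemiring
    using (solve; _:=_; _:+_; _:*_)
  open import Relation.Binary.Reasoning.Setoid setoid

  -- Ordered-field arithmetic.

  ≤-cong : ∀ {x y x′ y′} → x ≈ x′ → y ≈ y′ → x ≤ᵣ y → x′ ≤ᵣ y′
  ≤-cong x≈x′ y≈y′ x≤y = ≤.trans (≤.reflexive (sym x≈x′)) (≤.trans x≤y (≤.reflexive y≈y′))

  0≤-resp : ∀ {x y} → x ≈ y → 0# ≤ᵣ x → 0# ≤ᵣ y
  0≤-resp = ≤-cong refl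

  x≤y⇒0≤y-x : ∀ {x y} → x ≤ᵣ y → 0# ≤ᵣ y - x
  x≤y⇒0≤y-x {x} x≤y = ≤-cong (-‿inverseʳ x) refl (+-mono-≤ (- x) x≤y)

  0≤y-x⇒x≤y : ∀ {x y} → 0# ≤ᵣ y - x → x ≤ᵣ y
  0≤y-x⇒x≤y {x} {y} h = ≤-cong (+-identityˡ x) y-x+x≈y (+-mono-≤ x h)
    where
    y-x+x≈y : y - x + x ≈ y
    y-x+x≈y = trans (+-assoc y (- x) x) (trans (+-congˡ (-‿inverseˡ x)) (+-identityʳ y))

  x≤0⇒0≤-x : ∀ {x} → x ≤ᵣ 0# → 0# ≤ᵣ - x
  x≤0⇒0≤-x x≤0 = 0≤-resp (+-identityˡ _) (x≤y⇒0≤y-x x≤0)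

  0≤-x⇒x≤0 : ∀ {x} → 0# ≤ᵣ - x → x ≤ᵣ 0#
  0≤-x⇒x≤0 h = 0≤y-x⇒x≤y (0≤-resp (sym (+-identityˡ _)) h)

  +-nonneg : ∀ {x y} → 0# ≤ᵣ x → 0# ≤ᵣ y → 0# ≤ᵣ x + y
  +-nonneg {x} {y} 0≤x 0≤y = ≤.trans 0≤y (≤-cong (+-identityˡ y) refl (+-mono-≤ y 0≤x))

  nonneg-sum≈0⇒≈0 : ∀ {x y} → 0# ≤ᵣ x → 0# ≤ᵣ y → x + y ≈ 0# → x ≈ 0#
  nonneg-sum≈0⇒≈0 {x} {y} 0≤x 0≤y x+y≈0 =
    ≤.antisym (≤-cong (+-identityˡ x) (trans (+-comm y x) x+y≈0) (+-mono-≤ x 0≤y)) 0≤x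

  x*y≈0⇒y≈0 : ∀ {x y} → ¬ (x ≈ 0#) → x * y ≈ 0# → y ≈ 0#
  x*y≈0⇒y≈0 {x} {y} x≉0 xy≈0 with inverse x x≉0
  ... | u , xu≈1 = begin
    y            ≈⟨ *-identityˡ y ⟨
    1# * y       ≈⟨ *-congʳ (trans (sym xu≈1) (*-comm x u)) ⟩
    u * x * y    ≈⟨ *-assoc u x y ⟩
    u * (x * y)  ≈⟨ *-congˡ xy≈0 ⟩
    u * 0#       ≈⟨ zeroʳ u ⟩
    0#           ∎

  Positive : Carrier → Set
  Positive x = 0# ≤ᵣ x × ¬ (x ≈ 0#)

  Positive-resp : ∀ {x y} → x ≈ y → Positive x → Positive y
  Positive-resp x≈y (0≤x , x≉0) = 0≤-resp x≈y 0≤x , λ y≈0 → x≉0 (trans x≈y y≈0)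

  *-positive : ∀ {x y} → Positive x → Positive y → Positive (x * y)
  *-positive (0≤x , x≉0) (0≤y , y≉0) = *-nonneg 0≤x 0≤y , λ xy≈0 → y≉0 (x*y≈0⇒y≈0 x≉0 xy≈0)

  +-positive : ∀ {x y} → Positive x → 0# ≤ᵣ y → Positive (x + y)
  +-positive (0≤x , x≉0) 0≤y = +-nonneg 0≤x 0≤y , λ e → x≉0 (nonneg-sum≈0⇒≈0 0≤x 0≤y e)

  1-positive : Positive 1#
  1-positive = 0≤1 , λ 1≈0 → 0≉1 (sym 1≈0)
    where
    0≤1 : 0# ≤ᵣ 1#
    0≤1 with ≤.total 0# 1#
    ... | inj₁ h = h
    ... | inj₂ h = 0≤-resp (trans (sym (-‿distribˡ-* 1# (- 1#)))
                             (trans (-‿cong (*-identityˡ _)) (-‿involutive 1#)))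
                     (*-nonneg (x≤0⇒0≤-x h) (x≤0⇒0≤-x h))

  positive-inverse : ∀ {x} → Positive x → ∃[ u ] Positive u × x * u ≈ 1#
  positive-inverse {x} (0≤x , x≉0) with inverse x x≉0
  ... | u , xu≈1 = u , (0≤u , u≉0) , xu≈1
    where
    u≉0 : ¬ (u ≈ 0#)
    u≉0 u≈0 = 0≉1 (trans (sym (trans (*-congˡ u≈0) (zeroʳ x))) xu≈1)
    0≤u : 0# ≤ᵣ u
    0≤u with ≤.total 0# u
    ... | inj₁ h = h
    ... | inj₂ u≤0 = ⊥-elim (proj₂ 1-positive (≤.antisym 1≤0 (proj₁ 1-positive)))
      where
      1≤0 : 1# ≤ᵣ 0#
      1≤0 = 0≤-x⇒x≤0 (0≤-resp (trans (sym (-‿distribʳ-* x u)) (-‿cong xu≈1))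
                        (*-nonneg 0≤x (x≤0⇒0≤-x u≤0)))

  sum-nonneg : ∀ {n} {f : Vector Carrier n} → (∀ i → 0# ≤ᵣ f i) → 0# ≤ᵣ sum f
  sum-nonneg {zero}  f≥0 = ≤.refl
  sum-nonneg {suc n} f≥0 = +-nonneg (f≥0 zero) (sum-nonneg (f≥0 ∘ suc))

  sum-nonneg≈0⇒≈0 : ∀ {n} {f : Vector Carrier n} → (∀ i → 0# ≤ᵣ f i) → sum f ≈ 0# → ∀ i → f i ≈ 0#
  sum-nonneg≈0⇒≈0 f≥0 Σ≈0 zero    = nonneg-sum≈0⇒≈0 (f≥0 zero) (sum-nonneg (f≥0 ∘ suc)) Σ≈0
  sum-nonneg≈0⇒≈0 f≥0 Σ≈0 (suc i) = sum-nonneg≈0⇒≈0 (f≥0 ∘ suc)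
    (nonneg-sum≈0⇒≈0 (sum-nonneg (f≥0 ∘ suc)) (f≥0 zero) (trans (+-comm _ _) Σ≈0)) i

  sum-zero : ∀ {n} {f : Vector Carrier n} → (∀ i → f i ≈ 0#) → sum f ≈ 0#
  sum-zero {n} f≈0 = trans (sum-cong-≋ f≈0) (sum-replicate-zero n)

  -- Homogeneous linear systems.

  cancel-by-neg-inverse : ∀ {x w} → w * x ≈ - 1# → ∀ s → s * w * x + s ≈ 0#
  cancel-by-neg-inverse {x} {w} wx≈-1 s = begin
    s * w * x + s      ≈⟨ +-congʳ (trans (*-assoc s w x) (*-congˡ wx≈-1)) ⟩
    s * - 1# + s       ≈⟨ +-congʳ (trans (sym (-‿distribʳ-* s 1#)) (-‿cong (*-identityʳ s))) ⟩
    - s + s            ≈⟨ -‿inverseˡ s ⟩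
    0#                 ∎

  -- Gaussian elimination by induction on the number `m` of equations; `A j k` is the coefficient of
  -- unknown `j` in equation `k`. If equation zero has no nonzero coefficient it is dropped,
  -- otherwise it serves to eliminate one unknown.
  nontrivial-solution : ∀ m n → m ℕ.< n → (A : Fin n → Fin m → Carrier) →
    Σ (Vector Carrier n) λ x → (∃[ i ] ¬ (x i ≈ 0#)) × (∀ k → sum (λ j → x j * A j k) ≈ 0#)
  nontrivial-solution zero    (suc n) _         A =
    (λ _ → 1#) , (zero , λ 1≈0 → 0≉1 (sym 1≈0)) , λ ()
  nontrivial-solution (suc m) (suc n) (s≤s m<n) A with em {P = ∃[ i ] ¬ (A i zero ≈ 0#)}
  ... | no ∄pivot = x , x≉0 , eqs
    where
    rec = nontrivial-solution m (suc n) (ℕ.m≤n⇒m≤1+n m<n) (λ j → A j ∘ suc)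
    x   = proj₁ rec
    x≉0 = proj₁ (proj₂ rec)
    A₀≈0 : ∀ j → A j zero ≈ 0#
    A₀≈0 j with em {P = A j zero ≈ 0#}
    ... | yes e = e
    ... | no ¬e = ⊥-elim (∄pivot (j , ¬e))
    eqs : ∀ k → sum (λ j → x j * A j k) ≈ 0#
    eqs zero    = sum-zero (λ j → trans (*-congˡ (A₀≈0 j)) (zeroʳ (x j)))
    eqs (suc k) = proj₂ (proj₂ rec) k
  ... | yes (i , Aᵢ≉0) = x , (punchIn i l , x≉0) , eqs
    where
    u = proj₁ (inverse (A i zero) Aᵢ≉0)
    w = - u
    w-inv : w * A i zero ≈ - 1#
    w-inv = trans (sym (-‿distribˡ-* u _)) (-‿cong (trans (*-comm u _) (proj₂ (inverse (A i zero) Aᵢ≉0))))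
    A′ = λ j → A (punchIn i j)
    -- As `w` is the negative inverse of the pivot, adding `w * A i (suc k)` times equation zero to
    -- equation `suc k` removes unknown `i`.
    rec = nontrivial-solution m n m<n (λ j k → A′ j (suc k) + A′ j zero * (w * A i (suc k)))
    y = proj₁ rec
    l = proj₁ (proj₁ (proj₂ rec))
    S = λ k → sum (λ j → y j * A′ j k)
    -- The value of unknown `i` is forced by equation zero.
    x = insertAt y i (S zero * w)
    x≉0 : ¬ (x (punchIn i l) ≈ 0#)
    x≉0 e = proj₂ (proj₁ (proj₂ rec)) (trans (reflexive (≡.sym (insertAt-punchIn y i _ l))) e)
    split : ∀ k → sum (λ j → x j * A j k) ≈ S zero * w * A i k + S k
    split k = trans (sum-remove {i = i} (λ j → x j * A j k))
      (+-cong (*-congʳ (reflexive (insertAt-lookup y i _)))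
              (sum-cong-≋ (λ j → *-congʳ (reflexive (insertAt-punchIn y i _ j)))))
    eqs : ∀ k → sum (λ j → x j * A j k) ≈ 0#
    eqs zero    = trans (split zero) (cancel-by-neg-inverse w-inv (S zero))
    eqs (suc k) = begin
      sum (λ j → x j * A j (suc k))             ≈⟨ split (suc k) ⟩
      S zero * w * A i (suc k) + S (suc k)      ≈⟨ +-comm _ _ ⟩
      S (suc k) + S zero * w * A i (suc k)      ≈⟨ +-congˡ (trans (*-assoc _ _ _) (*-distribʳ-sum q (λ j → y j * A′ j zero))) ⟩
      S (suc k) + sum (λ j → y j * A′ j zero * q)
        ≈⟨ ∑-distrib-+ (λ j → y j * A′ j (suc k)) (λ j → y j * A′ j zero * q) ⟨
      sum (λ j → y j * A′ j (suc k) + y j * A′ j zero * q)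
        ≈⟨ sum-cong-≋ (λ j → trans (+-congˡ (*-assoc _ _ _)) (sym (distribˡ (y j) _ _))) ⟩
      sum (λ j → y j * (A′ j (suc k) + A′ j zero * q))  ≈⟨ proj₂ (proj₂ rec) k ⟩
      0#                                        ∎
      where q = w * A i (suc k)

  -- The ratio test.

  neg-inverse : ∀ {y} → y ≤ᵣ 0# → ¬ (y ≈ 0#) → ∃[ u ] 0# ≤ᵣ u × u * y ≈ - 1#
  neg-inverse {y} y≤0 y≉0
    with positive-inverse (x≤0⇒0≤-x y≤0 , λ e → y≉0 (trans (sym (-‿involutive y)) (trans (-‿cong e) -0#≈0#)))
  ... | u , (0≤u , _) , -yu≈1 = u , 0≤u , (begin
    u * y          ≈⟨ *-comm u y ⟩
    y * u          ≈⟨ -‿involutive _ ⟨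
    - - (y * u)    ≈⟨ -‿cong (trans (-‿distribˡ-* y u) -yu≈1) ⟩
    - 1#           ∎)

  -- The line `c + t b` lies at `t` on the boundary of the nonnegative orthant. The vanishing
  -- coordinate must have `b j` nonzero: in the rotation this keeps the newly tight generator off
  -- the hyperplane that supplies `b`.
  TouchesZero : ∀ {n} → Vector Carrier n → Vector Carrier n → Carrier → Set
  TouchesZero c b t =
    (∃[ j ] ¬ (b j ≈ 0#) × c j + t * b j ≈ 0#) × (∀ j → 0# ≤ᵣ c j + t * b j)

  -- Induction on the coordinates, keeping the smaller of two steps: the one found for the tail and,
  -- if the head decreases, the one at which the head vanishes. In the first alternative no
  -- coordinate ever decreases.
  ratio-test⁺ : ∀ {n} (c b : Vector Carrier n) → (∀ j → 0# ≤ᵣ c j) →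
    (∀ j → 0# ≤ᵣ b j) ⊎ (∃[ t ] 0# ≤ᵣ t × TouchesZero c b t)
  ratio-test⁺ {zero}  c b c≥0 = inj₁ λ ()
  ratio-test⁺ {suc n} c b c≥0 with em {P = 0# ≤ᵣ b zero} | ratio-test⁺ (c ∘ suc) (b ∘ suc) (c≥0 ∘ suc)
  ... | yes 0≤b₀ | inj₁ b≥0 = inj₁ λ { zero → 0≤b₀ ; (suc j) → b≥0 j }
  ... | yes 0≤b₀ | inj₂ (t , 0≤t , (j , bⱼ≉0 , eq) , ge) =
    inj₂ (t , 0≤t , (suc j , bⱼ≉0 , eq) ,
      λ { zero → +-nonneg (c≥0 zero) (*-nonneg 0≤t 0≤b₀) ; (suc j) → ge j })
  ... | no 0≰b₀ | tail = inj₂ (from-tail tail)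
    where
    x = c zero
    y = b zero
    y≉0 : ¬ (y ≈ 0#)
    y≉0 e = 0≰b₀ (≤.reflexive (sym e))
    y≤0 : y ≤ᵣ 0#
    y≤0 with ≤.total 0# y
    ... | inj₁ h = ⊥-elim (0≰b₀ h)
    ... | inj₂ h = h
    u = proj₁ (neg-inverse y≤0 y≉0)
    0≤u = proj₁ (proj₂ (neg-inverse y≤0 y≉0))
    uy≈-1 = proj₂ (proj₂ (neg-inverse y≤0 y≉0))
    -- `u` is `- 1 / y`, so this is the step `- x / y` at which the head reaches zero.
    t₀ = x * u
    0≤t₀ : 0# ≤ᵣ t₀
    0≤t₀ = *-nonneg (c≥0 zero) 0≤u
    eq₀ : x + t₀ * y ≈ 0#
    eq₀ = trans (+-comm _ _) (cancel-by-neg-inverse uy≈-1 x)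
    from-head : (∀ j → 0# ≤ᵣ c (suc j) + t₀ * b (suc j)) → ∃[ t ] 0# ≤ᵣ t × TouchesZero c b t
    from-head ge = t₀ , 0≤t₀ , (zero , y≉0 , eq₀) ,
      λ { zero → ≤.reflexive (sym eq₀) ; (suc j) → ge j }
    from-tail : (∀ j → 0# ≤ᵣ b (suc j)) ⊎ (∃[ t ] 0# ≤ᵣ t × TouchesZero (c ∘ suc) (b ∘ suc) t) →
                ∃[ t ] 0# ≤ᵣ t × TouchesZero c b t
    from-tail (inj₁ b≥0) = from-head (λ j → +-nonneg (c≥0 (suc j)) (*-nonneg 0≤t₀ (b≥0 j)))
    from-tail (inj₂ (t , 0≤t , (j , bⱼ≉0 , eq) , ge)) with ≤.total 0# (x + t * y)
    ... | inj₁ 0≤ = t , 0≤t , (suc j , bⱼ≉0 , eq) , λ { zero → 0≤ ; (suc j) → ge j }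
    ... | inj₂ ≤0 = from-head ge₀
      where
      -- This is `t - t₀`, nonnegative because the head is at most zero at `t`. Going back by `δ`
      -- cannot decrease a coordinate with `b j` at most zero.
      δ = - (x + t * y) * u
      0≤δ : 0# ≤ᵣ δ
      0≤δ = *-nonneg (x≤0⇒0≤-x ≤0) 0≤u
      t≈t₀+δ : t ≈ t₀ + δ
      t≈t₀+δ = sym (begin
        x * u + - (x + t * y) * u          ≈⟨ distribʳ u x _ ⟨
        (x + - (x + t * y)) * u            ≈⟨ *-congʳ (+-congˡ (sym (-‿+-comm x (t * y)))) ⟩
        (x + (- x + - (t * y))) * u        ≈⟨ *-congʳ (+-assoc x (- x) _) ⟨
        (x + - x + - (t * y)) * u          ≈⟨ *-congʳ (trans (+-congʳ (-‿inverseʳ x)) (+-identityˡ _)) ⟩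
        - (t * y) * u                      ≈⟨ -‿distribˡ-* (t * y) u ⟨
        - (t * y * u)                      ≈⟨ -‿cong (trans (*-assoc t y u) (*-congˡ (trans (*-comm y u) uy≈-1))) ⟩
        - (t * - 1#)                       ≈⟨ -‿cong (trans (sym (-‿distribʳ-* t 1#)) (-‿cong (*-identityʳ t))) ⟩
        - - t                              ≈⟨ -‿involutive t ⟩
        t                                  ∎)
      ge₀ : ∀ j → 0# ≤ᵣ c (suc j) + t₀ * b (suc j)
      ge₀ j with ≤.total 0# (b (suc j))
      ... | inj₁ 0≤bⱼ = +-nonneg (c≥0 (suc j)) (*-nonneg 0≤t₀ 0≤bⱼ)
      ... | inj₂ bⱼ≤0 = 0≤-resp (begin
        cⱼ + t * bⱼ + δ * - bⱼ                 ≈⟨ +-cong (+-congˡ (trans (*-congʳ t≈t₀+δ) (distribʳ bⱼ t₀ δ))) (sym (-‿distribʳ-* δ bⱼ)) ⟩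
        cⱼ + (t₀ * bⱼ + δ * bⱼ) - δ * bⱼ       ≈⟨ +-congʳ (+-assoc cⱼ _ _) ⟨
        cⱼ + t₀ * bⱼ + δ * bⱼ - δ * bⱼ         ≈⟨ +-assoc _ _ _ ⟩
        cⱼ + t₀ * bⱼ + (δ * bⱼ - δ * bⱼ)       ≈⟨ +-congˡ (-‿inverseʳ _) ⟩
        cⱼ + t₀ * bⱼ + 0#                      ≈⟨ +-identityʳ _ ⟩
        cⱼ + t₀ * bⱼ                           ∎)
        (+-nonneg (ge j) (*-nonneg 0≤δ (x≤0⇒0≤-x bⱼ≤0)))
        where
        cⱼ = c (suc j)
        bⱼ = b (suc j)

  -- If `b` is nonzero, then `b` or `- b` has a negative entry, so at least one direction is
  -- stopped. Hence `t` may have either sign.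
  ratio-test : ∀ {n} (c b : Vector Carrier n) → (∀ j → 0# ≤ᵣ c j) → ¬ (∀ j → b j ≈ 0#) →
    ∃[ t ] TouchesZero c b t
  ratio-test c b c≥0 b≉0 with ratio-test⁺ c b c≥0
  ... | inj₂ (t , _ , touches) = t , touches
  ... | inj₁ b≥0 with ratio-test⁺ c (λ j → - b j) c≥0
  ...   | inj₁ -b≥0 = ⊥-elim (b≉0 (λ j → ≤.antisym (0≤-x⇒x≤0 (-b≥0 j)) (b≥0 j)))
  ...   | inj₂ (t , _ , (j , -bⱼ≉0 , eq) , ge) =
    - t , (j , (λ bⱼ≈0 → -bⱼ≉0 (trans (-‿cong bⱼ≈0) -0#≈0#)) , trans (sym (move j)) eq) ,
    λ j → 0≤-resp (move j) (ge j)
    where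
    move : ∀ j → c j + t * - b j ≈ c j + - t * b j
    move j = +-congˡ (trans (sym (-‿distribʳ-* t (b j))) (-‿distribˡ-* t (b j)))

  module _ (d′ : ℕ) where

    -- Affine functionals and affine combinations, in dimension `suc d′`.

    open Polytopes ℝ (suc d′)

    -- The slack of the inequality at `x`: affine in `x` and linear in the pair `(a , ℓ)`, so that
    -- every position relative to a hyperplane becomes a comparison with zero.
    gap : Point → Carrier → Point → Carrier
    gap a ℓ x = ⟨ x , a ⟩ - ℓ

    gap-cong : ∀ a ℓ {x y} → x ≋ y → gap a ℓ x ≈ gap a ℓ y
    gap-cong a ℓ x≋y = +-congʳ (sum-cong-≋ (λ i → *-congʳ {a i} (x≋y i)))

    Hyp⇒gap≈0 : ∀ a ℓ x → x ∈ Hyp a ℓ → gap a ℓ x ≈ 0#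
    Hyp⇒gap≈0 a ℓ x = x≈y⇒x∙y⁻¹≈ε

    gap≈0⇒Hyp : ∀ a ℓ x → gap a ℓ x ≈ 0# → x ∈ Hyp a ℓ
    gap≈0⇒Hyp a ℓ x = x∙y⁻¹≈ε⇒x≈y _ _

    Hyp>⇒gap>0 : ∀ a ℓ x → x ∈ Hyp> a ℓ → Positive (gap a ℓ x)
    Hyp>⇒gap>0 a ℓ x (ℓ≤ , ℓ≉) = x≤y⇒0≤y-x ℓ≤ , λ e → ℓ≉ (sym (gap≈0⇒Hyp a ℓ x e))

    Hyp<⇒-gap>0 : ∀ a ℓ x → x ∈ Hyp< a ℓ → Positive (- gap a ℓ x)
    Hyp<⇒-gap>0 a ℓ x (≤ℓ , ≉ℓ) = Positive-resp -[ℓ-y]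
      (x≤y⇒0≤y-x ≤ℓ , λ e → ≉ℓ (sym (x∙y⁻¹≈ε⇒x≈y _ _ e)))
      where
      -[ℓ-y] : ℓ - ⟨ x , a ⟩ ≈ - (⟨ x , a ⟩ - ℓ)
      -[ℓ-y] = trans (+-comm _ _)
        (trans (+-congˡ (sym (-‿involutive ℓ))) (-‿+-comm _ (- ℓ)))

    ⟨comb,⟩ : ∀ {n} (w : Vector Carrier n) (p : Vector Point n) a →
      ⟨ comb w p , a ⟩ ≈ sum (λ j → w j * ⟨ p j , a ⟩)
    ⟨comb,⟩ w p a = begin
      sum (λ i → sum (λ j → w j * p j i) * a i)    ≈⟨ sum-cong-≋ (λ i → *-distribʳ-sum (a i) (λ j → w j * p j i)) ⟩
      sum (λ i → sum (λ j → w j * p j i * a i))    ≈⟨ ∑-comm (λ i j → w j * p j i * a i) ⟩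
      sum (λ j → sum (λ i → w j * p j i * a i))    ≈⟨ sum-cong-≋ (λ j → sum-cong-≋ (λ i → *-assoc (w j) (p j i) (a i))) ⟩
      sum (λ j → sum (λ i → w j * (p j i * a i)))  ≈⟨ sum-cong-≋ (λ j → *-distribˡ-sum (w j) (λ i → p j i * a i)) ⟨
      sum (λ j → w j * ⟨ p j , a ⟩)                ∎

    -- The total weight is left arbitrary to cover both affine combinations (weight one) and affine
    -- dependences (weight zero).
    sum-gap : ∀ {n} (w : Vector Carrier n) (p : Vector Point n) a ℓ →
      sum (λ j → w j * gap a ℓ (p j)) ≈ ⟨ comb w p , a ⟩ + sum w * - ℓ
    sum-gap w p a ℓ = begin
      sum (λ j → w j * gap a ℓ (p j))                        ≈⟨ sum-cong-≋ (λ j → distribˡ (w j) ⟨ p j , a ⟩ (- ℓ)) ⟩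
      sum (λ j → w j * ⟨ p j , a ⟩ + w j * - ℓ)              ≈⟨ ∑-distrib-+ (λ j → w j * ⟨ p j , a ⟩) (λ j → w j * - ℓ) ⟩
      sum (λ j → w j * ⟨ p j , a ⟩) + sum (λ j → w j * - ℓ)  ≈⟨ +-cong (⟨comb,⟩ w p a) (*-distribʳ-sum (- ℓ) w) ⟨
      ⟨ comb w p , a ⟩ + sum w * - ℓ                         ∎

    gap-comb : ∀ {n} (w : Vector Carrier n) (p : Vector Point n) a ℓ → sum w ≈ 1# →
      gap a ℓ (comb w p) ≈ sum (λ j → w j * gap a ℓ (p j))
    gap-comb w p a ℓ Σw≈1 = sym (trans (sum-gap w p a ℓ) (+-congˡ (trans (*-congʳ Σw≈1) (*-identityˡ _))))

    combine : Carrier → Carrier → Point → Point → Point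
    combine r s a b i = r * a i + s * b i

    gap-combine : ∀ r s a ℓ b m x →
      gap (combine r s a b) (r * ℓ + s * m) x ≈ r * gap a ℓ x + s * gap b m x
    gap-combine r s a ℓ b m x = begin
      ⟨ x , combine r s a b ⟩ - (r * ℓ + s * m)
        ≈⟨ +-cong inner (sym (-‿+-comm _ _)) ⟩
      r * ⟨ x , a ⟩ + s * ⟨ x , b ⟩ + (- (r * ℓ) + - (s * m))
        ≈⟨ +-congˡ (+-cong (-‿distribʳ-* r ℓ) (-‿distribʳ-* s m)) ⟩
      r * ⟨ x , a ⟩ + s * ⟨ x , b ⟩ + (r * - ℓ + s * - m)
        ≈⟨ solve 6 (λ r s A B L M → r :* A :+ s :* B :+ (r :* L :+ s :* M) := r :* (A :+ L) :+ s :* (B :+ M))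
             refl r s ⟨ x , a ⟩ ⟨ x , b ⟩ (- ℓ) (- m) ⟩
      r * gap a ℓ x + s * gap b m x  ∎
      where
      inner : ⟨ x , combine r s a b ⟩ ≈ r * ⟨ x , a ⟩ + s * ⟨ x , b ⟩
      inner = begin
        sum (λ i → x i * (r * a i + s * b i))
          ≈⟨ sum-cong-≋ (λ i → solve 5 (λ x r a s b → x :* (r :* a :+ s :* b) := r :* (x :* a) :+ s :* (x :* b))
               refl (x i) r (a i) s (b i)) ⟩
        sum (λ i → r * (x i * a i) + s * (x i * b i))
          ≈⟨ ∑-distrib-+ (λ i → r * (x i * a i)) (λ i → s * (x i * b i)) ⟩
        sum (λ i → r * (x i * a i)) + sum (λ i → s * (x i * b i))
          ≈⟨ +-cong (*-distribˡ-sum r (λ i → x i * a i)) (*-distribˡ-sum s (λ i → x i * b i)) ⟨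
        r * ⟨ x , a ⟩ + s * ⟨ x , b ⟩  ∎

    Flat : Point → Carrier → Region → Set
    Flat a ℓ X = ∀ x → x ∈ X → gap a ℓ x ≈ 0#

    aff-flat : ∀ X a ℓ → Flat a ℓ X → Flat a ℓ (aff X)
    aff-flat X a ℓ X⊆ x (n , p , w , p∈X , Σw≈1 , x≋) =
      trans (gap-cong a ℓ x≋) (trans (gap-comb w p a ℓ Σw≈1)
        (sum-zero (λ j → trans (*-congˡ (X⊆ (p j) (p∈X j))) (zeroʳ (w j)))))

    aff-range-flat : ∀ {n} (p : Vector Point n) a ℓ → (∀ j → gap a ℓ (p j) ≈ 0#) → Flat a ℓ (aff (range p))
    aff-range-flat p a ℓ p-on =
      aff-flat (range p) a ℓ (λ x (j , x≋) → trans (gap-cong a ℓ x≋) (p-on j))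

    conv⊆Hyp≥ : ∀ X a ℓ → (∀ x → x ∈ X → 0# ≤ᵣ gap a ℓ x) → ∀ x → x ∈ conv X → 0# ≤ᵣ gap a ℓ x
    conv⊆Hyp≥ X a ℓ X⊆ x (n , p , w , p∈X , w≥0 , Σw≈1 , x≋) =
      0≤-resp (sym (trans (gap-cong a ℓ x≋) (gap-comb w p a ℓ Σw≈1)))
        (sum-nonneg (λ j → *-nonneg (w≥0 j) (X⊆ (p j) (p∈X j))))

    -- Convex hulls of finitely many generators.

    ⊆conv : ∀ X → X ⊆ conv X
    ⊆conv X {x} x∈X = 1 , (λ _ → x) , (λ _ → 1#) , (λ _ → x∈X) , (λ _ → proj₁ 1-positive) ,
      +-identityʳ 1# , λ i → sym (trans (+-identityʳ _) (*-identityˡ (x i)))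

    -- The slice of height `s` of the homogenised cone over the generators. Unlike convex
    -- combinations, its elements can be added and scaled without normalising.
    Cone : ∀ {n} → Vector Point n → Carrier → Region
    Cone {n} p s x = Σ (Vector Carrier n) λ u → (∀ j → 0# ≤ᵣ u j) × sum u ≈ s × x ≋ comb u p

    Cone-resp : ∀ {n} {p : Vector Point n} {s t x y} → s ≈ t → x ≋ y → Cone p s x → Cone p t y
    Cone-resp s≈t x≋y (u , u≥0 , Σu , x≋) =
      u , u≥0 , trans Σu s≈t , λ i → trans (sym (x≋y i)) (x≋ i)

    Cone-zero : ∀ {n} {p : Vector Point n} → Cone p 0# (λ _ → 0#)
    Cone-zero {n} {p} = (λ _ → 0#) , (λ _ → ≤.refl) , sum-replicate-zero n ,
      λ i → sym (sum-zero (λ j → zeroˡ (p j i)))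

    Cone-+ : ∀ {n} {p : Vector Point n} {s t x y} → Cone p s x → Cone p t y →
      Cone p (s + t) (λ i → x i + y i)
    Cone-+ {p = p} (u , u≥0 , Σu , x≋) (w , w≥0 , Σw , y≋) =
      (λ j → u j + w j) , (λ j → +-nonneg (u≥0 j) (w≥0 j)) ,
      trans (∑-distrib-+ u w) (+-cong Σu Σw) ,
      λ i → trans (+-cong (x≋ i) (y≋ i)) (sym (trans
        (sum-cong-≋ (λ j → distribʳ (p j i) (u j) (w j)))
        (∑-distrib-+ (λ j → u j * p j i) (λ j → w j * p j i))))

    Cone-scale : ∀ {n} {p : Vector Point n} {s x} r → 0# ≤ᵣ r → Cone p s x →
      Cone p (r * s) (λ i → r * x i)
    Cone-scale {p = p} r 0≤r (u , u≥0 , Σu , x≋) =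
      (λ j → r * u j) , (λ j → *-nonneg 0≤r (u≥0 j)) ,
      trans (sym (*-distribˡ-sum r u)) (*-congˡ Σu) ,
      λ i → trans (*-congˡ (x≋ i)) (trans (*-distribˡ-sum r (λ j → u j * p j i))
        (sum-cong-≋ (λ j → sym (*-assoc r (u j) (p j i)))))

    Cone-generator : ∀ {n} (p : Vector Point n) j → Cone p 1# (p j)
    Cone-generator {suc n} p zero =
      (1# ∷ λ _ → 0#) , (λ { zero → proj₁ 1-positive ; (suc _) → ≤.refl }) ,
      trans (+-congˡ (sum-replicate-zero n)) (+-identityʳ 1#) ,
      λ i → sym (trans (+-cong (*-identityˡ _) (sum-zero (λ j → zeroˡ (p (suc j) i)))) (+-identityʳ _))
    Cone-generator p (suc j) with Cone-generator (p ∘ suc) j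
    ... | u , u≥0 , Σu , x≋ =
      (0# ∷ u) , (λ { zero → ≤.refl ; (suc k) → u≥0 k }) ,
      trans (+-identityˡ _) Σu ,
      λ i → trans (x≋ i) (sym (trans (+-congʳ (zeroˡ _)) (+-identityˡ _)))

    -- A point of weight zero may lie anywhere; this disposes of copies of `v` in a combination that
    -- does not really use `v`.
    Cone-comb : ∀ {n m} {p : Vector Point n} (w : Vector Carrier m) (x : Vector Point m) →
      (∀ j → 0# ≤ᵣ w j) → (∀ j → Cone p 1# (x j) ⊎ w j ≈ 0#) → Cone p (sum w) (comb w x)
    Cone-comb {m = zero}  w x w≥0 h = Cone-zero
    Cone-comb {m = suc m} {p} w x w≥0 h =
      Cone-+ (first (h zero)) (Cone-comb (w ∘ suc) (x ∘ suc) (w≥0 ∘ suc) (h ∘ suc))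
      where
      first : Cone p 1# (x zero) ⊎ w zero ≈ 0# → Cone p (w zero) (λ i → w zero * x zero i)
      first (inj₁ c)    = Cone-resp (*-identityʳ _) (λ _ → refl) (Cone-scale (w zero) (w≥0 zero) c)
      first (inj₂ w₀≈0) = Cone-resp (sym w₀≈0)
        (λ i → sym (trans (*-congʳ w₀≈0) (zeroˡ _))) Cone-zero

    -- A witness of `conv` is a list of any length, possibly with repetitions; its weights are
    -- regrouped into one weight per generator.
    conv⇒Cone : ∀ {n} {p : Vector Point n} {x} → x ∈ conv (range p) → Cone p 1# x
    conv⇒Cone {p = p} (m , q , w , q∈ , w≥0 , Σw≈1 , x≋) =
      Cone-resp Σw≈1 (λ i → sym (x≋ i)) (Cone-comb w q w≥0
        (λ j → inj₁ (Cone-resp refl (λ i → sym (proj₂ (q∈ j) i)) (Cone-generator p (proj₁ (q∈ j))))))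

    Cone⇒conv : ∀ {n} {p : Vector Point n} {x} → Cone p 1# x → x ∈ conv (range p)
    Cone⇒conv {n} {p} (u , u≥0 , Σu , x≋) = n , p , u , (λ j → j , λ _ → refl) , u≥0 , Σu , x≋

    -- Faces that survive the addition of `v`.

    -- Tilting the supporting hyperplane of G towards a facet hyperplane that contains G
    -- and has v strictly on its inner side makes it support conv (P ∪ {v}).
    face-beneath : ∀ {P G v} a ℓ → IsPolytope P → IsFace P G →
      P ⊆ Hyp≥ a ℓ → G ⊆ Hyp a ℓ → v ∈ Hyp> a ℓ → IsFace (conv (P ∪ (_≋ v))) G
    face-beneath {P} {G} {v} a ℓ (n , p , P⊆ , ⊆P) (b , m , P⊆b , G⊆ , ⊆G) P⊆a G⊆a v>a =
      combine A s b a , A * m + s * ℓ ,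
      (λ {x} x∈Q → 0≤y-x⇒x≤y (conv⊆Hyp≥ (P ∪ (_≋ v)) c e gap≥0 x x∈Q)) ,
      (λ {x} x∈G → ⊆conv (P ∪ (_≋ v)) (inj₁ (proj₁ (G⊆ x∈G))) , gap≈0⇒Hyp c e x (G⇒gap≈0 x∈G)) ,
      λ {x} (x∈Q , x∈c) → Q∩⊆G x x∈Q (Hyp⇒gap≈0 c e x x∈c)
      where
      A = gap a ℓ v
      B = gap b m v
      A>0 : Positive A
      A>0 = Hyp>⇒gap>0 a ℓ v v>a
      -- The tilted inequality has gap `A * (s + B)` at `v`, so `s` only has to be nonnegative and
      -- exceed `- B`.
      tilt : ∃[ s ] 0# ≤ᵣ s × Positive (s + B)
      tilt with ≤.total 0# B
      ... | inj₁ 0≤B = 1# , proj₁ 1-positive , +-positive 1-positive 0≤B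
      ... | inj₂ B≤0 = 1# - B , +-nonneg (proj₁ 1-positive) (x≤0⇒0≤-x B≤0) ,
        Positive-resp (sym (trans (+-assoc 1# (- B) B) (trans (+-congˡ (-‿inverseˡ B)) (+-identityʳ 1#)))) 1-positive
      s = proj₁ tilt
      0≤s = proj₁ (proj₂ tilt)
      c = combine A s b a
      e = A * m + s * ℓ
      gap≈ : ∀ x → gap c e x ≈ A * gap b m x + s * gap a ℓ x
      gap≈ = gap-combine A s b m a ℓ
      gap-v>0 : Positive (gap c e v)
      gap-v>0 = Positive-resp (sym (trans (gap≈ v)
          (solve 3 (λ A B s → A :* B :+ s :* A := A :* (s :+ B)) refl A B s)))
        (*-positive A>0 (proj₂ (proj₂ tilt)))
      b≥0 : ∀ {x} → x ∈ P → 0# ≤ᵣ A * gap b m x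
      b≥0 x∈P = *-nonneg (proj₁ A>0) (x≤y⇒0≤y-x (P⊆b x∈P))
      a≥0 : ∀ {x} → x ∈ P → 0# ≤ᵣ s * gap a ℓ x
      a≥0 x∈P = *-nonneg 0≤s (x≤y⇒0≤y-x (P⊆a x∈P))
      gap≥0 : ∀ x → x ∈ P ∪ (_≋ v) → 0# ≤ᵣ gap c e x
      gap≥0 x (inj₁ x∈P) = 0≤-resp (sym (gap≈ x)) (+-nonneg (b≥0 x∈P) (a≥0 x∈P))
      gap≥0 x (inj₂ x≋v) = 0≤-resp (gap-cong c e (λ i → sym (x≋v i))) (proj₁ gap-v>0)
      G⇒gap≈0 : ∀ {x} → x ∈ G → gap c e x ≈ 0#
      G⇒gap≈0 {x} x∈G = trans (gap≈ x) (trans (+-cong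
        (trans (*-congˡ (Hyp⇒gap≈0 b m x (proj₂ (G⊆ x∈G)))) (zeroʳ A))
        (trans (*-congˡ (Hyp⇒gap≈0 a ℓ x (G⊆a x∈G))) (zeroʳ s))) (+-identityʳ 0#))
      Q∩⊆G : ∀ x → x ∈ conv (P ∪ (_≋ v)) → gap c e x ≈ 0# → x ∈ G
      Q∩⊆G x (k , q , w , q∈ , w≥0 , Σw≈1 , x≋) gx≈0 = ⊆G (x∈P , gap≈0⇒Hyp b m x b≈0)
        where
        -- A sum of nonnegative terms vanishes termwise. The gap at `v` is positive, so `v` has
        -- weight zero and `x` lies in `P`.
        terms≈0 : ∀ j → w j * gap c e (q j) ≈ 0#
        terms≈0 = sum-nonneg≈0⇒≈0 (λ j → *-nonneg (w≥0 j) (gap≥0 (q j) (q∈ j)))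
          (trans (sym (trans (gap-cong c e x≋) (gap-comb w q c e Σw≈1))) gx≈0)
        v-unused : ∀ j → Cone p 1# (q j) ⊎ w j ≈ 0#
        v-unused j with q∈ j
        ... | inj₁ qⱼ∈P = inj₁ (conv⇒Cone (P⊆ qⱼ∈P))
        ... | inj₂ qⱼ≋v = inj₂ (x*y≈0⇒y≈0
          (λ g≈0 → proj₂ gap-v>0 (trans (gap-cong c e (λ i → sym (qⱼ≋v i))) g≈0))
          (trans (*-comm _ _) (terms≈0 j)))
        x∈P : x ∈ P
        x∈P = ⊆P (Cone⇒conv (Cone-resp Σw≈1 (λ i → sym (x≋ i)) (Cone-comb w q w≥0 v-unused)))
        b≈0 : gap b m x ≈ 0#
        b≈0 = x*y≈0⇒y≈0 (proj₂ A>0)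
          (nonneg-sum≈0⇒≈0 (b≥0 x∈P) (a≥0 x∈P) (trans (sym (gap≈ x)) gx≈0))

    -- Hyperplanes and affine independence.

    -- d + 1 points of a hyperplane: solve for an affine dependence in all coordinates but
    -- one with b i ≉ 0; the hyperplane equation then settles coordinate i.
    on-hyperplane⇒dependent : ∀ b m i → ¬ (b i ≈ 0#) → (e : Vector Point (suc (suc d′))) →
      (∀ k → gap b m (e k) ≈ 0#) → ¬ AffinelyIndependent e
    on-hyperplane⇒dependent b m i bᵢ≉0 e e-on indep =
      proj₂ w≉0 (indep w Σw≈0 y≈0 (proj₁ w≉0))
      where
      -- Equation zero makes the weights sum to zero, the other `d′` treat the coordinates different
      -- from `i`. There is one more unknown than there are equations.
      A : Fin (suc (suc d′)) → Fin (suc d′) → Carrier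
      A k zero    = 1#
      A k (suc j) = e k (punchIn i j)
      sol = nontrivial-solution (suc d′) (suc (suc d′)) ℕ.≤-refl A
      w = proj₁ sol
      w≉0 = proj₁ (proj₂ sol)
      Σw≈0 : sum w ≈ 0#
      Σw≈0 = trans (sum-cong-≋ (λ k → sym (*-identityʳ (w k)))) (proj₂ (proj₂ sol) zero)
      y = comb w e
      off-i : ∀ j → y (punchIn i j) ≈ 0#
      off-i j = proj₂ (proj₂ sol) (suc j)
      ⟨y,b⟩≈0 : ⟨ y , b ⟩ ≈ 0#
      ⟨y,b⟩≈0 = begin
        ⟨ y , b ⟩                        ≈⟨ trans (+-congˡ (trans (*-congʳ Σw≈0) (zeroˡ _))) (+-identityʳ _) ⟨
        ⟨ y , b ⟩ + sum w * - m          ≈⟨ sum-gap w e b m ⟨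
        sum (λ k → w k * gap b m (e k))  ≈⟨ sum-zero (λ k → trans (*-congˡ (e-on k)) (zeroʳ (w k))) ⟩
        0#                               ∎
      at-i : y i ≈ 0#
      at-i = x*y≈0⇒y≈0 bᵢ≉0 (begin
        b i * y i                                                 ≈⟨ *-comm _ _ ⟩
        y i * b i                                                 ≈⟨ +-identityʳ _ ⟨
        y i * b i + 0#                                            ≈⟨ +-congˡ (sum-zero (λ j → trans (*-congʳ (off-i j)) (zeroˡ (b (punchIn i j))))) ⟨
        y i * b i + sum (λ j → y (punchIn i j) * b (punchIn i j)) ≈⟨ sum-remove {i = i} (λ j → y j * b j) ⟨
        ⟨ y , b ⟩                                                 ≈⟨ ⟨y,b⟩≈0 ⟩
        0#                                                        ∎)
      y≈0 : y ≋ (λ _ → 0#)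
      y≈0 j with i ≟ᶠ j
      ... | yes ≡.refl = at-i
      ... | no i≢j = ≡.subst (λ k → y k ≈ 0#) (punchIn-punchOut i≢j) (off-i (punchOut i≢j))

    full⇒not-flat : ∀ {P} b m i → HasDim P (suc d′) → ¬ (b i ≈ 0#) → ¬ Flat b m P
    full⇒not-flat b m i (e , e∈P , indep , _) bᵢ≉0 flat =
      on-hyperplane⇒dependent b m i bᵢ≉0 e (λ k → flat (e k) (e∈P k)) indep

    -- With zero normal the gap would be constant.
    separates⇒nonzero : ∀ a ℓ x y → gap a ℓ x ≈ 0# → ¬ (gap a ℓ y ≈ 0#) → ∃[ i ] ¬ (a i ≈ 0#)
    separates⇒nonzero a ℓ x y x-on y-off with em {P = ∃[ i ] ¬ (a i ≈ 0#)}
    ... | yes a≉0 = a≉0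
    ... | no ∄ = ⊥-elim (y-off (trans (+-congʳ (trans (⟨,a⟩≈0 y) (sym (⟨,a⟩≈0 x)))) x-on))
      where
      a≈0 : ∀ i → a i ≈ 0#
      a≈0 i with em {P = a i ≈ 0#}
      ... | yes e = e
      ... | no ¬e = ⊥-elim (∄ (i , ¬e))
      ⟨,a⟩≈0 : ∀ z → ⟨ z , a ⟩ ≈ 0#
      ⟨,a⟩≈0 z = sum-zero (λ i → trans (*-congˡ (a≈0 i)) (zeroʳ (z i)))

    -- The unknowns are the level and the `suc d′` coordinates of the normal, and each point gives
    -- one linear equation, so up to `suc d′` points leave a nontrivial solution.
    hyperplane-through : ∀ {n} → suc n ℕ.≤ suc d′ → (y : Vector Point (suc n)) →
      Σ Point λ b → ∃[ m ] (∃[ i ] ¬ (b i ≈ 0#)) × (∀ j → gap b m (y j) ≈ 0#)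
    hyperplane-through {n} n≤d′ y = b , m , b≉0 , on
      where
      A : Fin (suc (suc d′)) → Fin (suc n) → Carrier
      A zero    j = - 1#
      A (suc i) j = y j i
      sol = nontrivial-solution (suc n) (suc (suc d′)) (s≤s n≤d′) A
      b = proj₁ sol ∘ suc
      m = proj₁ sol zero
      on : ∀ j → gap b m (y j) ≈ 0#
      on j = trans (trans (+-comm _ _) (+-cong
          (trans (-‿cong (sym (*-identityʳ m))) (-‿distribʳ-* m 1#))
          (sum-cong-≋ (λ i → *-comm (y j i) (b i)))))
        (proj₂ (proj₂ sol) j)
      b≉0 : ∃[ i ] ¬ (b i ≈ 0#)
      b≉0 with proj₁ (proj₂ sol)
      ... | suc i , bᵢ≉0 = i , bᵢ≉0
      -- If the level is the nonzero unknown, the hyperplane misses the origin but meets `y zero`,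
      -- so its normal is nonzero as well.
      ... | zero  , m≉0  = separates⇒nonzero b m (y zero) (λ _ → 0#) (on zero)
        (λ g≈0 → m≉0 (sym (trans (sym (sum-zero (λ i → zeroˡ (b i))))
                                 (gap≈0⇒Hyp b m (λ _ → 0#) g≈0))))

    -- A dependence whose first weight vanishes is a dependence of `e`, so only that weight needs an
    -- argument.
    independent-∷⁺ : ∀ {n} {e : Vector Point n} {x} → AffinelyIndependent e →
      (∀ w → sum w ≈ 0# → comb w (x ∷ e) ≋ (λ _ → 0#) → w zero ≈ 0#) →
      AffinelyIndependent (x ∷ e)
    independent-∷⁺ indep w₀≈0 w Σw≈0 y≈0 zero    = w₀≈0 w Σw≈0 y≈0
    independent-∷⁺ indep w₀≈0 w Σw≈0 y≈0 (suc j) = indep (w ∘ suc)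
      (trans (sym (trans (+-congʳ (w₀≈0 w Σw≈0 y≈0)) (+-identityˡ _))) Σw≈0)
      (λ i → trans (sym (trans (+-congʳ (trans (*-congʳ (w₀≈0 w Σw≈0 y≈0)) (zeroˡ _))) (+-identityˡ _))) (y≈0 i))
      j

    -- Applying the gap to a dependence kills every term except that of `x`.
    off-hyperplane⇒independent : ∀ {n} (e : Vector Point n) b m x → AffinelyIndependent e →
      (∀ k → gap b m (e k) ≈ 0#) → ¬ (gap b m x ≈ 0#) → AffinelyIndependent (x ∷ e)
    off-hyperplane⇒independent e b m x indep e-on x-off = independent-∷⁺ indep λ w Σw≈0 y≈0 →
      x*y≈0⇒y≈0 x-off (begin
        gap b m x * w zero                             ≈⟨ *-comm _ _ ⟩
        w zero * gap b m x                             ≈⟨ +-identityʳ _ ⟨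
        w zero * gap b m x + 0#                        ≈⟨ +-congˡ (sum-zero (λ k → trans (*-congˡ (e-on k)) (zeroʳ (w (suc k))))) ⟨
        sum (λ j → w j * gap b m ((x ∷ e) j))          ≈⟨ sum-gap w (x ∷ e) b m ⟩
        ⟨ comb w (x ∷ e) , b ⟩ + sum w * - m           ≈⟨ +-cong (sum-zero (λ i → trans (*-congʳ (y≈0 i)) (zeroˡ (b i)))) (trans (*-congʳ Σw≈0) (zeroˡ _)) ⟩
        0# + 0#                                        ≈⟨ +-identityʳ 0# ⟩
        0#                                             ∎)

    -- If `x` had nonzero weight in a dependence, dividing by it would express `x` as an affine
    -- combination of `e`.
    outside-aff⇒independent : ∀ {n} {e : Vector Point n} {x} → AffinelyIndependent e →
      x ∉ aff (range e) → AffinelyIndependent (x ∷ e)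
    outside-aff⇒independent {n} {e} {x} indep x∉ = independent-∷⁺ indep w₀≈0
      where
      w₀≈0 : ∀ w → sum w ≈ 0# → comb w (x ∷ e) ≋ (λ _ → 0#) → w zero ≈ 0#
      w₀≈0 w Σw≈0 y≈0 with em {P = w zero ≈ 0#}
      ... | yes e = e
      ... | no w₀≉0 = ⊥-elim (x∉ (n , e , (λ j → - u * w (suc j)) , (λ j → j , λ _ → refl) ,
          -- `isolate` is applied to `1#` for the total weight and to `x i` for the coordinates.
          trans (sym (*-distribˡ-sum (- u) (w ∘ suc)))
            (sym (isolate 1# _ (trans (+-congʳ (*-identityʳ _)) Σw≈0))) ,
          λ i → trans (isolate (x i) _ (y≈0 i)) (trans (*-distribˡ-sum (- u) (λ j → w (suc j) * e j i))
            (sum-cong-≋ (λ j → sym (*-assoc (- u) (w (suc j)) (e j i)))))))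
        where
        u = proj₁ (inverse (w zero) w₀≉0)
        isolate : ∀ z T → w zero * z + T ≈ 0# → z ≈ - u * T
        isolate z T eq = begin
          z                     ≈⟨ *-identityˡ z ⟨
          1# * z                ≈⟨ *-congʳ (trans (sym (proj₂ (inverse (w zero) w₀≉0))) (*-comm _ _)) ⟩
          u * w zero * z        ≈⟨ *-assoc _ _ _ ⟩
          u * (w zero * z)      ≈⟨ *-congˡ (+-inverseˡ-unique _ _ eq) ⟩
          u * - T               ≈⟨ trans (sym (-‿distribʳ-* u T)) (-‿distribˡ-* u T) ⟩
          - u * T               ∎

    -- Rotation of a supporting hyperplane into a facet.

    -- The invariant of the rotation. `G-spanned` expresses through hyperplanes that `G` lies in the
    -- affine hull of the tight points; it survives the addition of points and finally places `G` in
    -- the facet.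
    record SupportBeneath (P G : Region) (v : Point) (k : ℕ) : Set where
      field
        normal      : Point
        level       : Carrier
        points      : Vector Point (suc k)
        valid       : ∀ x → x ∈ P → 0# ≤ᵣ gap normal level x
        beneath     : Positive (gap normal level v)
        points∈P    : ∀ i → points i ∈ P
        points-on   : ∀ i → gap normal level (points i) ≈ 0#
        independent : AffinelyIndependent points
        G-spanned   : ∀ b m → (∀ i → gap b m (points i) ≈ 0#) → Flat b m G

    -- Rotate the supporting hyperplane about an axis through the points on it and v,
    -- until it hits a further generator of P.
    rotate : ∀ {P G v k} → IsFullPolytope P → suc k ℕ.≤ d′ →
      SupportBeneath P G v k → SupportBeneath P G v (suc k)
    rotate {P} {G} {v} {k} ((n , p , P⊆ , ⊆P) , full) k<d′ S = record
      { normal      = a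
      ; level       = ℓ
      ; points      = p j₀ ∷ points
      ; valid       = λ x x∈P → conv⊆Hyp≥ (range p) a ℓ generators-valid x (P⊆ x∈P)
      ; beneath     = Positive-resp (sym (gap-axis v (axis zero))) beneath
      ; points∈P    = λ { zero → generator∈P j₀ ; (suc i) → points∈P i }
      ; points-on   = λ { zero → trans (gap≈ (p j₀)) (proj₂ (proj₂ (proj₁ (proj₂ hit))))
                        ; (suc i) → trans (gap-axis (points i) (axis (suc i))) (points-on i) }
      ; independent = off-hyperplane⇒independent points b m (p j₀) independent (axis ∘ suc)
                        (proj₁ (proj₂ (proj₁ (proj₂ hit))))
      ; G-spanned   = λ b′ m′ on → G-spanned b′ m′ (on ∘ suc)
      }
      where
      open SupportBeneath S
      generator∈P : ∀ j → p j ∈ P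
      generator∈P j = ⊆P (⊆conv (range p) (j , λ _ → refl))
      -- `v` and the `suc k` tight points are at most `suc d′` points, because `suc k` is at most
      -- `d′`.
      through = hyperplane-through (s≤s k<d′) (v ∷ points)
      b = proj₁ through
      m = proj₁ (proj₂ through)
      b≉0 = proj₁ (proj₂ (proj₂ through))
      axis : ∀ j → gap b m ((v ∷ points) j) ≈ 0#
      axis = proj₂ (proj₂ (proj₂ through))
      not-flat : ¬ (∀ j → gap b m (p j) ≈ 0#)
      not-flat flat = full⇒not-flat b m (proj₁ b≉0) full (proj₂ b≉0) P-flat
        where
        P-flat : Flat b m P
        P-flat x x∈P with P⊆ x∈P
        ... | l , q , w , q∈ , _ , Σw≈1 , x≋ =
          aff-range-flat p b m flat x (l , q , w , q∈ , Σw≈1 , x≋)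
      -- In the pencil `normal + t b` the gap of each generator is affine in `t`. The chosen `t`
      -- makes a generator off the hyperplane `b` tight and violates none.
      hit = ratio-test (λ j → gap normal level (p j)) (λ j → gap b m (p j))
        (λ j → valid (p j) (generator∈P j)) not-flat
      t = proj₁ hit
      j₀ = proj₁ (proj₁ (proj₂ hit))
      a = combine 1# t normal b
      ℓ = 1# * level + t * m
      gap≈ : ∀ x → gap a ℓ x ≈ gap normal level x + t * gap b m x
      gap≈ x = trans (gap-combine 1# t normal level b m x) (+-congʳ (*-identityˡ _))
      gap-axis : ∀ x → gap b m x ≈ 0# → gap a ℓ x ≈ gap normal level x
      gap-axis x x-on = trans (gap≈ x) (trans (+-congˡ (trans (*-congˡ x-on) (zeroʳ t))) (+-identityʳ _))
      generators-valid : ∀ x → x ∈ range p → 0# ≤ᵣ gap a ℓ x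
      generators-valid x (j , x≋) =
        0≤-resp (sym (trans (gap-cong a ℓ x≋) (gap≈ (p j)))) (proj₂ (proj₂ hit) j)

    rotate-to : ∀ {P G v k n} → IsFullPolytope P → k ≤′ n → n ℕ.≤ d′ →
      SupportBeneath P G v k → SupportBeneath P G v n
    rotate-to full ≤′-refl       _    S = S
    rotate-to full (≤′-step k≤n) n<d′ S =
      rotate full n<d′ (rotate-to full k≤n (ℕ.<⇒≤ n<d′) S)

    -- The `suc d′` tight points already span: a further point of the hyperplane outside their
    -- affine hull would give `suc (suc d′)` independent points on a hyperplane.
    support-is-facet : ∀ {P G v} (S : SupportBeneath P G v d′) → let open SupportBeneath S in
      IsFacet P (P ∩ Hyp normal level)
    support-is-facet {P} {v = v} S =
      (normal , level , (λ {x} x∈P → 0≤y-x⇒x≤y (valid x x∈P)) , (λ h → h) , (λ h → h)) ,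
      points , (λ i → points∈P i , gap≈0⇒Hyp normal level (points i) (points-on i)) ,
      independent , spanned
      where
      open SupportBeneath S
      nonzero = separates⇒nonzero normal level (points zero) v (points-on zero) (proj₂ beneath)
      spanned : P ∩ Hyp normal level ⊆ aff (range points)
      spanned {x} (_ , x-on) with em {P = x ∈ aff (range points)}
      ... | yes x∈ = x∈
      ... | no x∉ = ⊥-elim (on-hyperplane⇒dependent normal level (proj₁ nonzero) (proj₂ nonzero) (x ∷ points)
        (λ { zero → Hyp⇒gap≈0 normal level x x-on ; (suc i) → points-on i })
        (outside-aff⇒independent independent x∉))

    -- The side of a facet on which `v` lies, and the face criterion.

    -- The segment from x to v crosses Hyp b m, but stays strictly inside Hyp> a ℓ.
    beneath-not-beyond : ∀ a ℓ b m x v → Hyp b m ⊆ Hyp a ℓ →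
      Positive (gap a ℓ x) → Positive (gap a ℓ v) →
      0# ≤ᵣ gap b m x → Positive (- gap b m v) → Empty
    beneath-not-beyond a ℓ b m x v b⊆a aₓ>0 aᵥ>0 bₓ≥0 bᵥ<0 =
      proj₂ y-inside (Hyp⇒gap≈0 a ℓ y (b⊆a {y} (gap≈0⇒Hyp b m y y-on-b)))
      where
      X = gap b m x
      W = - gap b m v
      inv = positive-inverse (+-positive bᵥ<0 bₓ≥0)
      u = proj₁ inv
      u>0 = proj₁ (proj₂ inv)
      -- `u` is the inverse of `W + X`, so these weights give the point of the segment where the gap
      -- of `b` vanishes.
      w : Vector Carrier 2
      w = W * u ∷ X * u ∷ []
      q : Vector Point 2
      q = x ∷ v ∷ []
      y = comb w q
      Σw≈1 : sum w ≈ 1#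
      Σw≈1 = trans (+-congˡ (+-identityʳ _)) (trans (sym (distribʳ u W X)) (proj₂ (proj₂ inv)))
      y-on-b : gap b m y ≈ 0#
      y-on-b = begin
        gap b m y                              ≈⟨ gap-comb w q b m Σw≈1 ⟩
        W * u * X + (X * u * gap b m v + 0#)   ≈⟨ +-congˡ (+-identityʳ _) ⟩
        W * u * X + X * u * gap b m v
          ≈⟨ solve 4 (λ W u X V → W :* u :* X :+ X :* u :* V := X :* u :* (W :+ V)) refl W u X (gap b m v) ⟩
        X * u * (W + gap b m v)                ≈⟨ *-congˡ (-‿inverseˡ _) ⟩
        X * u * 0#                             ≈⟨ zeroʳ _ ⟩
        0#                                     ∎
      y-inside : Positive (gap a ℓ y)
      y-inside = Positive-resp
        (sym (trans (gap-comb w q a ℓ Σw≈1) (+-congˡ (+-identityʳ _))))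
        (+-positive (*-positive (*-positive bᵥ<0 u>0) aₓ>0)
                    (*-nonneg (*-nonneg bₓ≥0 (proj₁ u>0)) (proj₁ aᵥ>0)))

    support-beneath : ∀ {P G v k} → IsFullPolytope P → k ℕ.≤ d′ →
      G ⊆ P → v ∉ P → IsKFace (conv (P ∪ (_≋ v))) k G →
      SupportBeneath P G v d′
    support-beneath {P} {G} {v} full k≤d′ G⊆P v∉P
      ((a , ℓ , Q⊆ , G⊆ , ⊆G) , e , e∈G , indep , G⊆aff) =
      rotate-to full (ℕ.≤⇒≤′ k≤d′) ℕ.≤-refl record
        { normal      = a
        ; level       = ℓ
        ; points      = e
        ; valid       = λ x x∈P → x≤y⇒0≤y-x (Q⊆ (⊆conv (P ∪ (_≋ v)) (inj₁ x∈P)))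
        -- If the inequality were tight at `v`, then `v` would lie in `G` and hence in `P`.
        ; beneath     = x≤y⇒0≤y-x (Q⊆ v∈Q) , λ v-on → v∉P (G⊆P (⊆G (v∈Q , gap≈0⇒Hyp a ℓ v v-on)))
        ; points∈P    = λ i → G⊆P (e∈G i)
        ; points-on   = λ i → Hyp⇒gap≈0 a ℓ (e i) (proj₂ (G⊆ (e∈G i)))
        ; independent = indep
        ; G-spanned   = λ b m on x x∈G → aff-range-flat e b m on x (G⊆aff x∈G)
        }
      where
      v∈Q : v ∈ conv (P ∪ (_≋ v))
      v∈Q = ⊆conv (P ∪ (_≋ v)) (inj₂ (λ _ → refl))

    ⊆aff : ∀ X → X ⊆ aff X
    ⊆aff X {x} x∈X = 1 , (λ _ → x) , (λ _ → 1#) , (λ _ → x∈X) ,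
      +-identityʳ 1# , λ i → sym (trans (+-identityʳ _) (*-identityˡ (x i)))

    aff-support-flat : ∀ {P G v k} (S : SupportBeneath P G v k) → let open SupportBeneath S in
      Flat normal level (aff (P ∩ Hyp normal level))
    aff-support-flat {P} S = aff-flat (P ∩ Hyp normal level) normal level (λ x x∈F → Hyp⇒gap≈0 normal level x (proj₂ x∈F))
      where open SupportBeneath S

    -- The pair `(b , m)` given by `H⁻` need not be `(normal , level)`. Instead of comparing the two
    -- up to scaling, the segment argument is applied to a point of `P` off the facet; without such
    -- a point `P` would be flat.
    support-not-beyond : ∀ {P G v} → IsFullPolytope P → (S : SupportBeneath P G v d′) →
      let open SupportBeneath S in v ∉ H⁻ P (P ∩ Hyp normal level)
    support-not-beyond {P} {v = v} full S (b , m , ((_ , Hyp⊆) , P⊆) , v<) =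
      full⇒not-flat normal level (proj₁ nonzero) (proj₂ full) (proj₂ nonzero) flat
      where
      open SupportBeneath S
      nonzero = separates⇒nonzero normal level (points zero) v (points-on zero) (proj₂ beneath)
      flat : Flat normal level P
      flat x x∈P with em {P = gap normal level x ≈ 0#}
      ... | yes x-on = x-on
      ... | no x-off = ⊥-elim (beneath-not-beyond normal level b m x v
        (λ {y} y∈ → gap≈0⇒Hyp normal level y (aff-support-flat S y (Hyp⊆ y∈)))
        (valid x x∈P , x-off) beneath (x≤y⇒0≤y-x (P⊆ x∈P)) (Hyp<⇒-gap>0 b m v v<))

    pseudo-stacking-faces : (P S : Region) → IsFullPolytope P → (𝓕 𝓝 : Family) →
      (v : Point) → v ∈ V P S 𝓕 𝓝 → (k : ℕ) → k ℕ.≤ d′ → (G : Region) → IsKFace P k G →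
      IsKFace (conv (P ∪ (_≋ v))) k G
        ⇔ (∃[ F ] IsFacet P F × F ∉ (𝓕 ∪ 𝓝 ∪ (_≐ S)) × G ⊆ F)
    pseudo-stacking-faces P S full 𝓕 𝓝 v (v⁻ , v⁰ , v⁺) k k≤d′ G (G-face@(_ , _ , _ , G⊆ , _) , G-dim) =
      mk⇔ (λ G-Q → facet (support-beneath full k≤d′ G⊆P v∉P G-Q)) from
      where
      G⊆P : G ⊆ P
      G⊆P x∈G = proj₁ (G⊆ x∈G)
      v∉P : v ∉ P
      v∉P v∈P with v⁻ S (inj₂ ((λ h → h) , (λ h → h)))
      -- `v` strictly violates the inequality of `S`, which is valid on `P`.
      ... | a , ℓ , (_ , P⊆) , v≤ , v≉ = v≉ (≤.antisym v≤ (P⊆ v∈P))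
      facet : SupportBeneath P G v d′ → ∃[ F ] IsFacet P F × F ∉ (𝓕 ∪ 𝓝 ∪ (_≐ S)) × G ⊆ F
      facet B = F , support-is-facet B , F∉ , λ {x} x∈G →
          G⊆P x∈G , gap≈0⇒Hyp normal level x (G-spanned normal level points-on x x∈G)
        where
        open SupportBeneath B
        F = P ∩ Hyp normal level
        F∉ : F ∉ (𝓕 ∪ 𝓝 ∪ (_≐ S))
        -- Membership in `𝓕` would put `v` on the hyperplane of `F`; membership in `𝓝` or equality
        -- with `S` would put it beyond. Both contradict `beneath`.
        F∉ (inj₁ F∈𝓕) = proj₂ beneath (aff-support-flat B v (v⁰ F F∈𝓕))
        F∉ (inj₂ F∈)  = support-not-beyond full B (v⁻ F F∈)
      from : ∃[ F ] IsFacet P F × F ∉ (𝓕 ∪ 𝓝 ∪ (_≐ S)) × G ⊆ F → IsKFace (conv (P ∪ (_≋ v))) k G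
      from (F , F-facet , F∉ , G⊆F) with v⁺ F F-facet F∉
      ... | a , ℓ , ((aff⊆ , _) , P⊆) , v> =
        face-beneath a ℓ (proj₁ full) G-face P⊆ (λ x∈G → aff⊆ (⊆aff F (G⊆F x∈G))) v> , G-dim

theorem2p11 : (∀ {ℓ} → ExcludedMiddle ℓ) →
    (ℝ : CompleteOrderedField) (d : ℕ) → 3 ≤ d →
    let open Polytopes ℝ d in
    (P S : Region) → IsFullPolytope P →
    IsSimplexFacet P S → BoundedPosition P S →
    (𝓕 𝓝 : Family) → 𝓕 Respects _≐_ → 𝓝 Respects _≐_ →
    𝓕 ⊆ adj P S → 𝓝 ⊆ adj P S → 𝓕 ⊥ 𝓝 → Nonsimple P S 𝓕 →
    (v : Point) → v ∈ V P S 𝓕 𝓝 →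
    (k : ℕ) → k ≤ d ∸ 2 →
    (G : Region) → IsKFace P k G →
    IsKFace (conv (P ∪ (_≋ v))) k G
    ⇔ (∃[ F ] IsFacet P F × F ∉ (𝓕 ∪ 𝓝 ∪ (_≐ S)) × G ⊆ F)
theorem2p11 em ℝ (suc (suc d″)) (s≤s (s≤s _)) P S full _ _ 𝓕 𝓝 _ _ _ _ _ _ v v∈V k k≤d-2 =
  pseudo-stacking-faces em ℝ (suc d″) P S full 𝓕 𝓝 v v∈V k (ℕ.m≤n⇒m≤1+n k≤d-2)
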